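{- Let $P(\vec\alpha,\vec\beta,\vec\xi),P'(\vec\alpha,\vec\beta,\vec\xi)\in\mathcal{P}$ be two syntactically compositional predicates with the same parameters, and suppose $P'$ is stronger than $P$. Then the entailments $P'(\vec\alpha,\vec\beta,\vec\xi)\Rightarrow P(\vec\alpha,\vec\beta,\vec\xi)$ and $\exists\vec\beta.\ P'(\vec\alpha,\vec\beta,\vec\xi)\ast P(\vec\beta,\vec\gamma,\vec\xi)\Rightarrow P(\vec\alpha,\vec\gamma,\vec\xi)$ hold (for any pair $\vec\gamma$ of a location and a data variable).
   Context: Separation logic setting: location variables (interpreted in a set $\mathbb{L}$ of locations, with a constant ${\sf nil}$) and data variables; pointer fields $\mathcal{F}$ and data fields $\mathcal{D}$. A state is $(s,h)$ with $s$ a stack assigning values to variables and $h$ a finite partial heap mapping (location, field) pairs to locations or data values. Formulas: pure parts (location (dis)equalities and data constraints in a decidable theory), spatial parts $\mathtt{emp}$, $E\mapsto\rho$, predicate atoms, $\ast$ (separating conjunction over domain-disjoint heaps), with $\land,\lor,\exists$. Predicates are defined by finite sets of rules $Q(E,\vec F)::=\exists\vec Z.\Pi\land\Sigma$ with least-fixed-point semantics; an entailment $A\Rightarrow B$ means every $(s,h)$ satisfying $A$ satisfies $B$. Syntactic compositionality: $P$ has parameters $(\vec\alpha,\vec\beta,\vec\xi)$, $\vec\alpha=(E,C)$ (source), $\vec\beta=(F,H)$ (hole), $E,F$ location variables, $C,H$ data variables, $\vec\xi$ static parameters. $P$ is syntactically compositional if it has exactly one base rule $P(\vec\alpha,\vec\beta,\vec\xi)::=\alpha_1=\beta_1\land\alpha_2=\beta_2\land\mathtt{emp}$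 and at least one inductive rule, every inductive rule being of the form $P(\vec\alpha,\vec\beta,\vec\xi)::=\exists\vec Z.\ \Pi\land\Sigma_1\ast\Sigma_2\ast P(\vec\gamma,\vec\beta,\vec\xi)$ where $\Sigma_1$ is a nonempty separating conjunction of points-to atoms containing a unique points-to atom from $E$ and all location variables of $\vec Z$, whose Gaifman graph is a connected DAG rooted at $E$; $\Sigma_2$ is a possibly empty separating conjunction of predicate atoms whose first arguments are sink vertices of that graph; $\vec\gamma$ consists of variables of $\vec Z$; and the variables of $\vec\beta$ do not occur in $\Pi,\Sigma_1,\Sigma_2,\vec\gamma$. Stronger: $P'$ is stronger than $P$ if for each inductive rule $P'(\vec\alpha,\vec\beta,\vec\xi)::=\exists\vec Z.\ \Pi'\land\Sigma_1\ast\Sigma_2\ast P'(\vec\gamma,\vec\beta,\vec\xi)$ of $P'$ there is an inductive rule $P(\vec\alpha,\vec\beta,\vec\xi)::=\exists\vec Z.\ \Pi\land\Sigma_1\ast\Sigma_2\ast P(\vec\gamma,\vec\beta,\vec\xi)$ of $P$ (same $\vec Z,\Sigma_1,\Sigma_2,\vec\gamma$) such that $\Pi'\Rightarrow\Pi$ is valid. -}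

module Defs where

open import Data.Fin.Base using (Fin)
open import Data.List.Base using (List; []; _∷_; [_]; _++_; map; concat; concatMap; length; lookup)
open import Data.List.Membership.Propositional using (_∈_; _∉_)
open import Data.List.Membership.Propositional.Properties using (∈-++⁺ˡ; ∈-++⁺ʳ)
open import Data.List.Relation.Unary.All as All using (All; []; _∷_)
open import Data.List.Relation.Unary.All.Properties using (++⁺)
open import Data.List.Relation.Unary.Any using (here; there)
open import Data.Maybe using (Maybe; just; Is-just; _<∣>_)
open import Data.Nat.Base using (ℕ)
open import Data.Product using (∃; ∃₂; ∃!; _×_; _,_; -,_)
open import Data.Sum.Base using (_⊎_)
open import Data.Vec.Base as Vec using (Vec; []; _∷_)
open import Function.Bundles using (_⇔_)
open import Relation.Binary.Construct.Closure.ReflexiveTransitive using (Star)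
open import Relation.Binary.Construct.Closure.Transitive using (TransClosure)
open import Relation.Binary.PropositionalEquality using (_≡_; _≢_; refl)
open import Relation.Nullary using (¬_; Dec)

data Sort : Set where
  loc dat : Sort

-- A typing context; a variable of sort τ in Γ is a position τ ∈ Γ.
Ctx : Set
Ctx = List Sort

Vars : Ctx → Ctx → Set
Vars Γ Δ = All (_∈ Γ) Δ

-- Constraint n is the set of formulas of the theory with n free variables.
record DataTheory : Set₁ where
  field
    𝔻          : Set
    Constraint : ℕ → Set
    ⟦_⟧ᶜ       : ∀ {n} → Constraint n → Vec 𝔻 n → Set
    eqᶜ        : Constraint 2
    eqᶜ-sound  : ∀ x y → ⟦ eqᶜ ⟧ᶜ (x ∷ y ∷ []) ⇔ x ≡ y
    valid?     : ∀ {n} (φ : Constraint n) → Dec (∀ xs → ⟦ φ ⟧ᶜ xs)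

-- Pred Δ is the set of predicates Q(E, F⃗) where E is of sort loc and F⃗ has
-- sorts Δ.
record Signature : Set₁ where
  field
    theory : DataTheory
    𝕃      : Set
    nil𝕃   : 𝕃
    ℱ 𝒟    : Set
    Pred   : List Sort → Set
  open DataTheory theory public

module SL (S : Signature) where
  open Signature S

  Field : Sort → Set
  Field loc = ℱ
  Field dat = 𝒟

  Val : Sort → Set
  Val loc = 𝕃
  Val dat = 𝔻

  data Term (Γ : Ctx) : Sort → Set where
    var : ∀ {τ} → τ ∈ Γ → Term Γ τ
    nil : Term Γ loc

  Terms : Ctx → Ctx → Set
  Terms Γ Δ = All (Term Γ) Δ

  data PureAtom (Γ : Ctx) : Set where
    _≐_ _≠̇_ : Term Γ loc → Term Γ loc → PureAtom Γ
    con     : ∀ {n} → Constraint n → Vec (Term Γ dat) n → PureAtom Γ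

  record PointsTo (Γ : Ctx) : Set where
    constructor _↦_
    field
      source : loc ∈ Γ
      target : List (∃ λ τ → Field τ × Term Γ τ)

  record PredAtom (Γ : Ctx) : Set where
    constructor _⟨_⟩
    field
      {sorts} : List Sort
      pred    : Pred sorts
      args    : Terms Γ (loc ∷ sorts)

  data SpatialAtom (Γ : Ctx) : Set where
    pto : PointsTo Γ → SpatialAtom Γ
    app : PredAtom Γ → SpatialAtom Γ

  -- Lists of conjuncts: conjunction is _++_, and emp is the empty spatial
  -- formula, so both connectives are taken up to associativity and unit.
  Pure Spatial : Ctx → Set
  Pure Γ    = List (PureAtom Γ)
  Spatial Γ = List (SpatialAtom Γ)

  data Formula (Γ : Ctx) : Set where
    _∧̇_ : Pure Γ → Spatial Γ → Formula Γ
    _∨̇_ : Formula Γ → Formula Γ → Formula Γ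
    ∃̇   : ∀ {τ} → Formula (τ ∷ Γ) → Formula Γ

  ∃⃗ : ∀ {Γ} (Z : Ctx) → Formula (Z ++ Γ) → Formula Γ
  ∃⃗ []      φ = φ
  ∃⃗ (τ ∷ Z) φ = ∃⃗ Z (∃̇ φ)

  Var : Ctx → Set
  Var Γ = ∃ (_∈ Γ)

  module _ {Γ : Ctx} where

    varsᵗ : ∀ {τ} → Term Γ τ → List (Var Γ)
    varsᵗ (var x) = [ -, x ]
    varsᵗ nil     = []

    varsᵖ : PureAtom Γ → List (Var Γ)
    varsᵖ (t ≐ u)    = varsᵗ t ++ varsᵗ u
    varsᵖ (t ≠̇ u)    = varsᵗ t ++ varsᵗ u
    varsᵖ (con _ ts) = concatMap varsᵗ (Vec.toList ts)

    vars↦ : PointsTo Γ → List (Var Γ)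
    vars↦ (x ↦ ρ) = (-, x) ∷ concatMap (λ (_ , _ , t) → varsᵗ t) ρ

    vars⟨⟩ : PredAtom Γ → List (Var Γ)
    vars⟨⟩ (_ ⟨ ts ⟩) = concat (All.reduce varsᵗ ts)

  -- The Gaifman graph of a separating conjunction of points-to atoms. Its
  -- vertices are location variables; the constant nil is not a vertex.
  module Gaifman {Γ : Ctx} (Σ₁ : List (PointsTo Γ)) where

    Vertex : loc ∈ Γ → Set
    Vertex x = (loc , x) ∈ concatMap vars↦ Σ₁

    Edge : loc ∈ Γ → loc ∈ Γ → Set
    Edge x y = ∃₂ λ ρ (f : ℱ) → (x ↦ ρ) ∈ Σ₁ × (loc , f , var y) ∈ ρ

    Acyclic : Set
    Acyclic = ∀ x → ¬ TransClosure Edge x x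

    RootedAt : loc ∈ Γ → Set
    RootedAt r = Vertex r × (∀ x → Vertex x → Star Edge r x)

    Sink : loc ∈ Γ → Set
    Sink x = Vertex x × (∀ y → ¬ Edge x y)

  -- The variables of a rule body are the parameters followed by Z.
  record Rule (Δ : List Sort) : Set where
    constructor ∃[_]_∧_
    field
      Z       : Ctx
      pure    : Pure ((loc ∷ Δ) ++ Z)
      spatial : Spatial ((loc ∷ Δ) ++ Z)

  Definitions : Set
  Definitions = ∀ {Δ} → Pred Δ → List (Rule Δ)

  -- The sorts of α⃗, of β⃗ and of γ⃗: a location and a data variable.
  Pair : List Sort
  Pair = loc ∷ dat ∷ []

  -- The parameters (α⃗, β⃗, ξ⃗), where Ξ lists the sorts of ξ⃗.
  Params : List Sort → Ctx
  Params Ξ = Pair ++ Pair ++ Ξ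

  CPred : List Sort → Set
  CPred Ξ = Pred (dat ∷ Pair ++ Ξ)

  _⟨_∣_∣_⟩ : ∀ {Γ Ξ} → CPred Ξ → Vars Γ Pair → Vars Γ Pair → Vars Γ Ξ → SpatialAtom Γ
  P ⟨ as ∣ bs ∣ xs ⟩ = app (P ⟨ All.map var (++⁺ as (++⁺ bs xs)) ⟩)

  -- Rule bodies for parameters α⃗ = (E, C), β⃗ = (F, H), ξ⃗ and local variables Z.
  module Body (Ξ : List Sort) (Z : Ctx) where

    Scope : Ctx
    Scope = Params Ξ ++ Z

    E F : loc ∈ Scope
    E = here refl
    F = there (there (here refl))

    C H : dat ∈ Scope
    C = there (here refl)
    H = there (there (there (here refl)))

    β⃗ : Vars Scope Pair
    β⃗ = F ∷ H ∷ []

    ξ⃗ : Vars Scope Ξ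
    ξ⃗ = All.tabulate λ x → ∈-++⁺ˡ (∈-++⁺ʳ Pair (∈-++⁺ʳ Pair x))

    local : ∀ {τ} → τ ∈ Z → τ ∈ Scope
    local = ∈-++⁺ʳ (Params Ξ)

    recursiveRule : CPred Ξ → Pure Scope → List (PointsTo Scope) → List (PredAtom Scope) →
                    Vars Z Pair → Rule (dat ∷ Pair ++ Ξ)
    recursiveRule P Π Σ₁ Σ₂ γ⃗ =
      ∃[ Z ] Π ∧ (map pto Σ₁ ++ map app Σ₂ ++ [ P ⟨ All.map local γ⃗ ∣ β⃗ ∣ ξ⃗ ⟩ ])

  baseRule : ∀ Ξ → Rule (dat ∷ Pair ++ Ξ)
  baseRule Ξ = ∃[ [] ] (var E ≐ var F ∷ con eqᶜ (var C ∷ var H ∷ []) ∷ []) ∧ []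
    where open Body Ξ []

  record IsCompositionalRule {Ξ} (P : CPred Ξ) (R : Rule (dat ∷ Pair ++ Ξ)) : Set where
    field
      Z  : Ctx
    open Body Ξ Z
    field
      Π  : Pure Scope
      Σ₁ : List (PointsTo Scope)
      Σ₂ : List (PredAtom Scope)
      γ⃗  : Vars Z Pair
      shape : R ≡ recursiveRule P Π Σ₁ Σ₂ γ⃗
    open Gaifman Σ₁
    field
      Σ₁-nonempty : Σ₁ ≢ []
      Σ₁-unique-E : ∃! _≡_ λ (i : Fin (length Σ₁)) → PointsTo.source (lookup Σ₁ i) ≡ E
      Σ₁-locals   : ∀ (z : loc ∈ Z) → (loc , local z) ∈ concatMap vars↦ Σ₁
      Σ₁-acyclic  : Acyclic
      Σ₁-rooted   : RootedAt E
      Σ₂-sinks    : All (λ a → ∃ λ x → All.head (PredAtom.args a) ≡ var x × Sink x) Σ₂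
      -- γ⃗ consists of variables of Z, so β⃗ cannot occur in it.
      F-fresh     : (loc , F) ∉ concatMap varsᵖ Π ++ concatMap vars↦ Σ₁ ++ concatMap vars⟨⟩ Σ₂
      H-fresh     : (dat , H) ∉ concatMap varsᵖ Π ++ concatMap vars↦ Σ₁ ++ concatMap vars⟨⟩ Σ₂

  data IsPointsTo {Γ} : SpatialAtom Γ → Set where
    isPointsTo : ∀ {a} → IsPointsTo (pto a)

  -- A rule is a base rule if it has no predicate atoms, else inductive.
  IsBase IsInductive : ∀ {Δ} → Rule Δ → Set
  IsBase R      = All IsPointsTo (Rule.spatial R)
  IsInductive R = ¬ IsBase R

  Cell : Set
  Cell = 𝕃 × ∃ Field

  record Heap : Set where
    field
      read   : ((_ , τ , _) : Cell) → Maybe (Val τ)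
      finite : ∃ λ cells → ∀ c → Is-just (read c) → c ∈ cells

  open Heap public using (read)

  _∈dom_ : Cell → Heap → Set
  c ∈dom h = Is-just (read h c)

  _≔_⊎ʰ_ : Heap → Heap → Heap → Set
  h ≔ h₁ ⊎ʰ h₂ = (∀ c → ¬ (c ∈dom h₁ × c ∈dom h₂))
               × (∀ c → read h c ≡ (read h₁ c <∣> read h₂ c))

  Stack : Ctx → Set
  Stack Γ = All Val Γ

  ⟦_⟧ : ∀ {Γ τ} → Term Γ τ → Stack Γ → Val τ
  ⟦ var x ⟧ s = All.lookup s x
  ⟦ nil   ⟧ s = nil𝕃

  _⊨ᵖ_ : ∀ {Γ} → Stack Γ → PureAtom Γ → Set
  s ⊨ᵖ (t ≐ u)    = ⟦ t ⟧ s ≡ ⟦ u ⟧ s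
  s ⊨ᵖ (t ≠̇ u)    = ⟦ t ⟧ s ≢ ⟦ u ⟧ s
  s ⊨ᵖ (con φ ts) = ⟦ φ ⟧ᶜ (Vec.map (λ t → ⟦ t ⟧ s) ts)

  _⊨ᴾ_ : ∀ {Γ} → Stack Γ → Pure Γ → Set
  s ⊨ᴾ Π = All (s ⊨ᵖ_) Π

  _,_⊨↦_ : ∀ {Γ} → Stack Γ → Heap → PointsTo Γ → Set
  s , h ⊨↦ (x ↦ ρ) =
      (∀ {τ f t} → (τ , f , t) ∈ ρ → read h (⟦ var x ⟧ s , τ , f) ≡ just (⟦ t ⟧ s))
    × (∀ {l τ f} → (l , τ , f) ∈dom h → l ≡ ⟦ var x ⟧ s × ∃ λ t → (τ , f , t) ∈ ρ)

  module Semantics (rules : Definitions) where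

    -- vs , h ∈⟦ Q ⟧: the least solution of the rules, as an inductive family.
    data _,_∈⟦_⟧ : ∀ {Δ} → Stack (loc ∷ Δ) → Heap → Pred Δ → Set
    data _,_⊨ᵃ_ {Γ} (s : Stack Γ) (h : Heap) : SpatialAtom Γ → Set
    data _,_⊨ˢ_ {Γ} (s : Stack Γ) (h : Heap) : Spatial Γ → Set

    data _,_∈⟦_⟧ where
      unfold : ∀ {Δ} {Q : Pred Δ} {vs h} (R : Rule Δ) → R ∈ rules Q →
               (zs : Stack (Rule.Z R)) →
               ++⁺ vs zs ⊨ᴾ Rule.pure R →
               ++⁺ vs zs , h ⊨ˢ Rule.spatial R →
               vs , h ∈⟦ Q ⟧

    data _,_⊨ᵃ_ {Γ} s h where
      pto : ∀ {a} → s , h ⊨↦ a → s , h ⊨ᵃ pto a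
      app : ∀ {Δ} {Q : Pred Δ} {ts} →
            All.map (λ t → ⟦ t ⟧ s) ts , h ∈⟦ Q ⟧ → s , h ⊨ᵃ app (Q ⟨ ts ⟩)

    data _,_⊨ˢ_ {Γ} s h where
      emp  : (∀ c → ¬ (c ∈dom h)) → s , h ⊨ˢ []
      star : ∀ {a Σ h₁ h₂} → h ≔ h₁ ⊎ʰ h₂ →
             s , h₁ ⊨ᵃ a → s , h₂ ⊨ˢ Σ → s , h ⊨ˢ (a ∷ Σ)

    _,_⊨_ : ∀ {Γ} → Stack Γ → Heap → Formula Γ → Set
    s , h ⊨ (Π ∧̇ Σ) = s ⊨ᴾ Π × s , h ⊨ˢ Σ
    s , h ⊨ (φ ∨̇ ψ) = s , h ⊨ φ ⊎ s , h ⊨ ψ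
    s , h ⊨ ∃̇ φ     = ∃ λ v → (v ∷ s) , h ⊨ φ

    _⇛_ : ∀ {Γ} → Formula Γ → Formula Γ → Set
    φ ⇛ ψ = ∀ s h → s , h ⊨ φ → s , h ⊨ ψ

    record SyntacticallyCompositional {Ξ} (P : CPred Ξ) : Set where
      field
        base-rule       : baseRule Ξ ∈ rules P
        only-base-rule  : ∀ {R} → R ∈ rules P → IsBase R → R ≡ baseRule Ξ
        inductive-rule  : ∃ λ R → R ∈ rules P × IsInductive R
        inductive-rules : ∀ {R} → R ∈ rules P → IsInductive R → IsCompositionalRule P R

    _StrongerThan_ : ∀ {Ξ} → CPred Ξ → CPred Ξ → Set
    _StrongerThan_ {Ξ} P′ P =
      ∀ Z → let open Body Ξ Z in ∀ Π′ Σ₁ Σ₂ γ⃗ →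
      recursiveRule P′ Π′ Σ₁ Σ₂ γ⃗ ∈ rules P′ →
      ∃ λ Π → recursiveRule P Π Σ₁ Σ₂ γ⃗ ∈ rules P × (∀ s → s ⊨ᴾ Π′ → s ⊨ᴾ Π)

{-# OPTIONS --safe #-}
-- Append an α-to-β segment of P′ to a β-to-γ segment of P by induction on the
-- derivation of the P′-atom. At the base rule α⃗ = β⃗ and the first heap is empty,
-- so the second heap already is the required segment. At an inductive rule the
-- matching rule of P applies: nothing but the recursive atom mentions β⃗, so the
-- rest of the body survives the replacement of β⃗ by γ⃗. The first entailment is
-- the case of an empty second segment from β⃗ to β⃗.
module Submission where

open import Data.List.Base using (List; []; _∷_; [_]; _++_; map; concat; concatMap)
open import Data.List.Membership.Propositional using (_∈_; _∉_)
open import Data.List.Membership.Propositional.Properties using (∈-++⁺ˡ; ∈-++⁺ʳ)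
open import Data.List.Properties using (++-assoc)
open import Data.List.Relation.Unary.All as All using (All; []; _∷_)
open import Data.List.Relation.Unary.All.Properties as Allₚ using (++⁺; ++⁻ˡ; ++⁻ʳ)
open import Data.List.Relation.Unary.Any using (here; there)
open import Data.Maybe using (Maybe; just; nothing; Is-just; _<∣>_)
open import Data.Maybe.Properties using (<∣>-assoc; <∣>-identityʳ)
open import Data.Maybe.Relation.Unary.Any using (just)
open import Data.Product.Base using (_×_; _,_; proj₁; proj₂)
open import Data.Sum.Base using (_⊎_; inj₁; inj₂; [_,_]′)
open import Data.Vec.Base as Vec using (Vec; []; _∷_)
open import Function.Base using (_∘_)
open import Function.Bundles using (Equivalence)
open import Relation.Binary.PropositionalEquality
  using (_≡_; refl; sym; trans; cong; cong₂; subst)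
open import Relation.Nullary using (¬_; Dec; yes; no; contradiction)
open import Defs

-- Optional values and sort-indexed lists.

module _ {A : Set} where

  is-just-<∣>⁻ : ∀ (x y : Maybe A) → Is-just (x <∣> y) → Is-just x ⊎ Is-just y
  is-just-<∣>⁻ (just _) _ p = inj₁ p
  is-just-<∣>⁻ nothing  _ p = inj₂ p

  is-just-<∣>⁺ˡ : ∀ (x y : Maybe A) → Is-just x → Is-just (x <∣> y)
  is-just-<∣>⁺ˡ (just _) _ p = p

  is-just-<∣>⁺ʳ : ∀ (x y : Maybe A) → Is-just y → Is-just (x <∣> y)
  is-just-<∣>⁺ʳ (just _) _ _ = just _
  is-just-<∣>⁺ʳ nothing  _ p = p

  ¬is-just⇒nothing : ∀ (x : Maybe A) → ¬ Is-just x → x ≡ nothing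
  ¬is-just⇒nothing (just _) ¬p = contradiction (just _) ¬p
  ¬is-just⇒nothing nothing  _  = refl

concatMap⁻ : ∀ {A B : Set} {P : B → Set} (f : A → List B) (xs : List A) →
             All P (concatMap f xs) → All (λ x → All P (f x)) xs
concatMap⁻ f xs = Allₚ.map⁻ ∘ Allₚ.concat⁻ {xss = map f xs}

module _ {A : Set} {V : A → Set} where

  map-lookup-tabulate : ∀ {Γ Δ} (s : All V Γ) (vs : All V Δ) (g : ∀ {a} → a ∈ Δ → a ∈ Γ) →
    (∀ {a} (i : a ∈ Δ) → All.lookup s (g i) ≡ All.lookup vs i) →
    All.map (All.lookup s) (All.tabulate g) ≡ vs
  map-lookup-tabulate s []       g eq = refl
  map-lookup-tabulate s (v ∷ vs) g eq =
    cong₂ _∷_ (eq (here refl)) (map-lookup-tabulate s vs (g ∘ there) (eq ∘ there))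

  lookup-++⁺ˡ : ∀ {Γ Δ} (s : All V Γ) (t : All V Δ) {a} (i : a ∈ Γ) →
    All.lookup (++⁺ s t) (∈-++⁺ˡ i) ≡ All.lookup s i
  lookup-++⁺ˡ (v ∷ s) t (here refl) = refl
  lookup-++⁺ˡ (v ∷ s) t (there i)   = lookup-++⁺ˡ s t i

module _ (S : Signature) where
  open Signature S
  open SL S

  isPointsTo? : ∀ {Γ} (a : SpatialAtom Γ) → Dec (IsPointsTo a)
  isPointsTo? (pto _) = yes isPointsTo
  isPointsTo? (app _) = no λ ()

  -- Compositionality classifies rules only through `IsBase` and its negation, so a case split on
  -- the rule at the root of a derivation rests on this decision.
  isBase? : ∀ {Δ} (R : Rule Δ) → Dec (IsBase R)
  isBase? R = All.all? isPointsTo? (Rule.spatial R)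

  -- Disjoint union of heaps.

  Empty : Heap → Set
  Empty h = ∀ c → ¬ (c ∈dom h)

  ∅ : Heap
  ∅ = record { read = λ _ → nothing ; finite = [] , λ _ () }

  ∅-empty : Empty ∅
  ∅-empty _ ()

  _∪_ : Heap → Heap → Heap
  h₁ ∪ h₂ = record
    { read   = λ c → read h₁ c <∣> read h₂ c
    ; finite = proj₁ (Heap.finite h₁) ++ proj₁ (Heap.finite h₂) , λ c →
        [ ∈-++⁺ˡ ∘ proj₂ (Heap.finite h₁) c
        , ∈-++⁺ʳ (proj₁ (Heap.finite h₁)) ∘ proj₂ (Heap.finite h₂) c
        ]′ ∘ is-just-<∣>⁻ (read h₁ c) (read h₂ c)
    }

  -- Satisfaction looks only at `read`; propositional equality would also compare the `finite`
  -- witnesses and call for function extensionality.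
  _≗ʰ_ : Heap → Heap → Set
  h ≗ʰ k = ∀ c → read h c ≡ read k c

  ⊎ʰ-emptyʳ : ∀ {h k} → Empty k → h ≔ h ⊎ʰ k
  ⊎ʰ-emptyʳ {h} {k} k∅ = (λ c → k∅ c ∘ proj₂) , λ c →
    trans (sym (<∣>-identityʳ (read h c)))
          (cong (read h c <∣>_) (sym (¬is-just⇒nothing (read k c) (k∅ c))))

  ⊎ʰ-emptyˡ⁻ : ∀ {h h₁ h₂} → Empty h₁ → h ≔ h₁ ⊎ʰ h₂ → h₂ ≗ʰ h
  ⊎ʰ-emptyˡ⁻ {h₁ = h₁} {h₂} h₁∅ (_ , eq) c =
    sym (trans (eq c) (cong (_<∣> read h₂ c) (¬is-just⇒nothing (read h₁ c) (h₁∅ c))))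

  ⊎ʰ-emptyʳ⁻ : ∀ {h h₁ h₂} → Empty h₂ → h ≔ h₁ ⊎ʰ h₂ → h₁ ≗ʰ h
  ⊎ʰ-emptyʳ⁻ {h₁ = h₁} {h₂} h₂∅ (_ , eq) c =
    sym (trans (eq c) (trans (cong (read h₁ c <∣>_) (¬is-just⇒nothing (read h₂ c) (h₂∅ c)))
                             (<∣>-identityʳ (read h₁ c))))

  ⊎ʰ-respˡ : ∀ {h k₁ h₁ h₂} → k₁ ≗ʰ h₁ → h ≔ h₁ ⊎ʰ h₂ → h ≔ k₁ ⊎ʰ h₂
  ⊎ʰ-respˡ {h₂ = h₂} k₁≗h₁ (disjoint , eq) =
      (λ c (p , q) → disjoint c (subst Is-just (k₁≗h₁ c) p , q))
    , λ c → trans (eq c) (cong (_<∣> read h₂ c) (sym (k₁≗h₁ c)))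

  ∈dom-⊎ʰˡ : ∀ {h h₁ h₂ c} → h ≔ h₁ ⊎ʰ h₂ → c ∈dom h₁ → c ∈dom h
  ∈dom-⊎ʰˡ {c = c} (_ , eq) p = subst Is-just (sym (eq c)) (is-just-<∣>⁺ˡ _ _ p)

  ∈dom-⊎ʰʳ : ∀ {h h₁ h₂ c} → h ≔ h₁ ⊎ʰ h₂ → c ∈dom h₂ → c ∈dom h
  ∈dom-⊎ʰʳ {h₁ = h₁} {c = c} (_ , eq) p =
    subst Is-just (sym (eq c)) (is-just-<∣>⁺ʳ (read h₁ c) _ p)

  -- Since `k₁` and `k₂` lie inside `h₁`, both are disjoint from `h₂`. This regrouping moves the
  -- heap of the second segment past one atom of a rule body.
  ⊎ʰ-assoc : ∀ {h h₁ h₂ k₁ k₂} → h ≔ h₁ ⊎ʰ h₂ → h₁ ≔ k₁ ⊎ʰ k₂ →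
             (h ≔ k₁ ⊎ʰ (k₂ ∪ h₂)) × ((k₂ ∪ h₂) ≔ k₂ ⊎ʰ h₂)
  ⊎ʰ-assoc {h} {h₁} {h₂} {k₁} {k₂} h≔@(disjoint , eq) h₁≔@(disjoint₁ , eq₁) =
      ( (λ c (p , q) → [ (λ r → disjoint₁ c (p , r))
                       , (λ r → disjoint c (∈dom-⊎ʰˡ {h₁} {k₁} {k₂} h₁≔ p , r))
                       ]′ (is-just-<∣>⁻ (read k₂ c) (read h₂ c) q))
      , λ c → trans (eq c) (trans (cong (_<∣> read h₂ c) (eq₁ c))
                                  (<∣>-assoc (read k₁ c) (read k₂ c) (read h₂ c))))
    , ( (λ c (p , q) → disjoint c (∈dom-⊎ʰʳ {h₁} {k₁} {k₂} h₁≔ p , q))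
      , λ _ → refl)

  -- Satisfaction depends only on the values of occurring variables.

  module _ {Γ : Ctx} where

    Agree : Stack Γ → Stack Γ → List (Var Γ) → Set
    Agree s t = All λ (_ , x) → All.lookup s x ≡ All.lookup t x

    module _ (s t : Stack Γ) where

      ⟦⟧-cong : ∀ {τ} (u : Term Γ τ) → Agree s t (varsᵗ u) → ⟦ u ⟧ s ≡ ⟦ u ⟧ t
      ⟦⟧-cong (var x) (eq ∷ []) = eq
      ⟦⟧-cong nil     []        = refl

      ⟦⟧-cong-vec : ∀ {n} (us : Vec (Term Γ dat) n) →
        Agree s t (concatMap varsᵗ (Vec.toList us)) →
        Vec.map (λ u → ⟦ u ⟧ s) us ≡ Vec.map (λ u → ⟦ u ⟧ t) us
      ⟦⟧-cong-vec []       _   = refl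
      ⟦⟧-cong-vec (u ∷ us) agr =
        cong₂ _∷_ (⟦⟧-cong u (++⁻ˡ (varsᵗ u) agr)) (⟦⟧-cong-vec us (++⁻ʳ (varsᵗ u) agr))

      ⟦⟧-cong-terms : ∀ {Δ} (us : Terms Γ Δ) → Agree s t (concat (All.reduce varsᵗ us)) →
        All.map (λ u → ⟦ u ⟧ s) us ≡ All.map (λ u → ⟦ u ⟧ t) us
      ⟦⟧-cong-terms []       _   = refl
      ⟦⟧-cong-terms (u ∷ us) agr =
        cong₂ _∷_ (⟦⟧-cong u (++⁻ˡ (varsᵗ u) agr)) (⟦⟧-cong-terms us (++⁻ʳ (varsᵗ u) agr))

      ⊨ᵖ-cong : ∀ (π : PureAtom Γ) → Agree s t (varsᵖ π) → s ⊨ᵖ π → t ⊨ᵖ π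
      ⊨ᵖ-cong (u ≐ v) agr u≡v =
        trans (sym (⟦⟧-cong u (++⁻ˡ (varsᵗ u) agr))) (trans u≡v (⟦⟧-cong v (++⁻ʳ (varsᵗ u) agr)))
      ⊨ᵖ-cong (u ≠̇ v) agr u≢v u≡v = u≢v
        (trans (⟦⟧-cong u (++⁻ˡ (varsᵗ u) agr)) (trans u≡v (sym (⟦⟧-cong v (++⁻ʳ (varsᵗ u) agr)))))
      ⊨ᵖ-cong (con φ us) agr = subst ⟦ φ ⟧ᶜ (⟦⟧-cong-vec us agr)

      ⊨ᴾ-cong : ∀ (Π : Pure Γ) → Agree s t (concatMap varsᵖ Π) → s ⊨ᴾ Π → t ⊨ᴾ Π
      ⊨ᴾ-cong Π agr sΠ =
        All.zipWith (λ {π} (agrπ , sπ) → ⊨ᵖ-cong π agrπ sπ) (concatMap⁻ varsᵖ Π agr , sΠ)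

      ⊨↦-cong : ∀ {h} (a : PointsTo Γ) → Agree s t (vars↦ a) → s , h ⊨↦ a → t , h ⊨↦ a
      ⊨↦-cong {h} (x ↦ ρ) (x≡ ∷ agr) (cells , only) =
          (λ {τ} {f} {u} i →
            subst (λ l → read h (l , τ , f) ≡ just (⟦ u ⟧ t)) x≡
              (trans (cells i)
                (cong just (⟦⟧-cong u
                  (All.lookup (concatMap⁻ (λ (_ , _ , v) → varsᵗ v) ρ agr) i)))))
        , (λ c∈h → trans (proj₁ (only c∈h)) x≡ , proj₂ (only c∈h))

  -- Derivations under a change of stack or heap.

  module _ (rules : Definitions) where
    open Semantics rules

    -- Quantifying over the heap allows transfers to be collected before the heap is split, and
    -- treats both kinds of atom alike.
    Transfers : ∀ {Γ} → Stack Γ → Stack Γ → SpatialAtom Γ → Set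
    Transfers s t a = ∀ h → s , h ⊨ᵃ a → t , h ⊨ᵃ a

    module _ {Γ : Ctx} (s t : Stack Γ) where

      pto-transfers : (a : PointsTo Γ) → Agree s t (vars↦ a) → Transfers s t (pto a)
      pto-transfers a agr h (pto p) = pto (⊨↦-cong s t {h} a agr p)

      -- Predicates are interpreted over argument values, so the derivation carries over whole,
      -- without induction.
      app-transfers : (a : PredAtom Γ) → Agree s t (vars⟨⟩ a) → Transfers s t (app a)
      app-transfers (Q ⟨ us ⟩) agr h (app d) =
        app (subst (_, h ∈⟦ Q ⟧) (⟦⟧-cong-terms s t us agr) d)

      body-transfers : ∀ Σ₁ Σ₂ → Agree s t (concatMap vars↦ Σ₁ ++ concatMap vars⟨⟩ Σ₂) →
        All (Transfers s t) (map pto Σ₁ ++ map app Σ₂)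
      body-transfers Σ₁ Σ₂ agr = ++⁺
        (Allₚ.map⁺ (All.map (λ {a} → pto-transfers a)
          (concatMap⁻ vars↦ Σ₁ (++⁻ˡ (concatMap vars↦ Σ₁) agr))))
        (Allₚ.map⁺ (All.map (λ {a} → app-transfers a)
          (concatMap⁻ vars⟨⟩ Σ₂ (++⁻ʳ (concatMap vars↦ Σ₁) agr))))

    -- The heap occurs only in the outermost constructor; the parts of a split stay the same, so one
    -- case split suffices.
    ⊨ˢ-resp : ∀ {Γ} {s : Stack Γ} {h k Σ} → h ≗ʰ k → s , h ⊨ˢ Σ → s , k ⊨ˢ Σ
    ⊨ˢ-resp h≗k (emp h∅)                    = emp λ c → h∅ c ∘ subst Is-just (sym (h≗k c))
    ⊨ˢ-resp h≗k (star (disjoint , eq) a Σ) =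
      star (disjoint , λ c → trans (sym (h≗k c)) (eq c)) a Σ

    ∈⟦⟧-resp : ∀ {Δ} {vs : Stack (loc ∷ Δ)} {h k} {Q : Pred Δ} →
               h ≗ʰ k → vs , h ∈⟦ Q ⟧ → vs , k ∈⟦ Q ⟧
    ∈⟦⟧-resp h≗k (unfold R R∈ zs Π Σ) = unfold R R∈ zs Π (⊨ˢ-resp h≗k Σ)

    -- Values of the parameters of a segment.

    module _ {Ξ : List Sort} where

      params : 𝕃 → 𝔻 → 𝕃 → 𝔻 → Stack Ξ → Stack (Params Ξ)
      params e c f d x = e ∷ c ∷ f ∷ d ∷ x

      -- The recursive atom hands on the static parameters unchanged. For an arbitrary `Ξ` this
      -- takes an induction, whereas the two pairs evaluate by computation.
      ξ⃗-value : ∀ {Z} e c f d (x : Stack Ξ) (zs : Stack Z) →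
        All.map (λ u → ⟦ u ⟧ (++⁺ (params e c f d x) zs)) (All.map var (Body.ξ⃗ Ξ Z)) ≡ x
      ξ⃗-value {Z} e c f d x zs = trans (Allₚ.map-∘ (Body.ξ⃗ Ξ Z))
        (map-lookup-tabulate (++⁺ (params e c f d x) zs) x _ (lookup-++⁺ˡ x zs))

      atom-stack : ∀ {Γ} (s : Stack Γ) (as bs : Vars Γ Pair) (xs : Vars Γ Ξ) → Stack (Params Ξ)
      atom-stack s (a₁ ∷ a₂ ∷ []) (b₁ ∷ b₂ ∷ []) xs =
        params (All.lookup s a₁) (All.lookup s a₂) (All.lookup s b₁) (All.lookup s b₂)
          (All.map (All.lookup s) xs)

      atom-stack-correct : ∀ {Γ} (s : Stack Γ) (as bs : Vars Γ Pair) (xs : Vars Γ Ξ) →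
        All.map (λ u → ⟦ u ⟧ s) (All.map var (++⁺ as (++⁺ bs xs))) ≡ atom-stack s as bs xs
      atom-stack-correct s (a₁ ∷ a₂ ∷ []) (b₁ ∷ b₂ ∷ []) xs =
        cong (params _ _ _ _) (Allₚ.map-∘ xs)

      module _ {Z : Ctx} (e : 𝕃) (c : 𝔻) (f f′ : 𝕃) (d d′ : 𝔻) (x : Stack Ξ) (zs : Stack Z) where
        open Body Ξ Z

        -- The stacks can differ only at the positions of `F` and `H`, which freshness excludes;
        -- elsewhere both lookups compute to the same value.
        agree-off-β⃗ : ∀ vs → (loc , F) ∉ vs → (dat , H) ∉ vs →
          Agree (++⁺ (params e c f d x) zs) (++⁺ (params e c f′ d′ x) zs) vs
        agree-off-β⃗ vs F∉ H∉ = All.tabulate (agree _)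
          where
          agree : ∀ ((_ , v) : Var Scope) → (_ , v) ∈ vs →
            All.lookup (++⁺ (params e c f d x) zs) v ≡ All.lookup (++⁺ (params e c f′ d′ x) zs) v
          agree (_ , here refl)                         _ = refl
          agree (_ , there (here refl))                 _ = refl
          agree (_ , there (there (here refl)))         i = contradiction i F∉
          agree (_ , there (there (there (here refl)))) i = contradiction i H∉
          agree (_ , there (there (there (there _))))   _ = refl

      -- Concatenation of segments.

      module _ (P P′ : CPred Ξ) (scP : SyntacticallyCompositional P)
               (scP′ : SyntacticallyCompositional P′) (P′≽P : P′ StrongerThan P) where

        empty-segment : ∀ e c x {h} → Empty h → params e c e c x , h ∈⟦ P ⟧
        empty-segment e c x h∅ =
          unfold (baseRule Ξ) (SyntacticallyCompositional.base-rule scP) []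
            (refl ∷ Equivalence.from (eqᶜ-sound c c) refl ∷ []) (emp h∅)

        -- Propositional equations for vs and Σ, instead of transporting derivations,
        -- keep the mutual recursion structural on the derivation of P′.
        append : ∀ e c f d f′ d′ x {vs} h h₁ h₂ → vs ≡ params e c f d x →
          vs , h₁ ∈⟦ P′ ⟧ → params f d f′ d′ x , h₂ ∈⟦ P ⟧ → h ≔ h₁ ⊎ʰ h₂ →
          params e c f′ d′ x , h ∈⟦ P ⟧

        -- Runs along the rule body: each atom of `Θ` keeps its heap and changes its stack, while
        -- the second segment is pushed right until it meets the recursive atom.
        append-body : ∀ {Z} e c f d f′ d′ x (zs : Stack Z) (γ⃗ : Vars Z Pair) →
          let open Body Ξ Z
              s  = ++⁺ (params e c f d x) zs
              s′ = ++⁺ (params e c f′ d′ x) zs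
          in ∀ Θ {Σ} → Σ ≡ Θ ++ [ P′ ⟨ All.map local γ⃗ ∣ β⃗ ∣ ξ⃗ ⟩ ] →
          All (Transfers s s′) Θ →
          ∀ h h₁ h₂ →
          s , h₁ ⊨ˢ Σ → params f d f′ d′ x , h₂ ∈⟦ P ⟧ → h ≔ h₁ ⊎ʰ h₂ →
          s′ , h ⊨ˢ (Θ ++ [ P ⟨ All.map local γ⃗ ∣ β⃗ ∣ ξ⃗ ⟩ ])

        append e c f d f′ d′ x h h₁ h₂ refl (unfold R R∈ zs Π Σ) seg h≔
          with isBase? R
        ... | yes base
          with refl ← SyntacticallyCompositional.only-base-rule scP′ R∈ base
          with [] ← zs | refl ∷ c≡d ∷ [] ← Π | emp h₁∅ ← Σ
          -- The data equality is a constraint of the abstract theory, so it becomes an identity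
          -- only through `eqᶜ-sound`.
          with refl ← Equivalence.to (eqᶜ-sound c d) c≡d
          = ∈⟦⟧-resp (⊎ʰ-emptyˡ⁻ {h} {h₁} {h₂} h₁∅ h≔) seg
        ... | no ¬base
          with record { Z = Z ; Π = Π′ ; Σ₁ = Σ₁ ; Σ₂ = Σ₂ ; γ⃗ = γ⃗ ; shape = refl
                      ; F-fresh = F-fresh ; H-fresh = H-fresh }
                 ← SyntacticallyCompositional.inductive-rules scP′ R∈ ¬base
          -- Matching `shape` has turned `R` into a recursive rule, so `R∈` has the form that
          -- strength expects.
          with Πₚ , RP∈ , Π′⇒Πₚ ← P′≽P Z Π′ Σ₁ Σ₂ γ⃗ R∈
          = unfold _ RP∈ zs
              -- `Π′` changes stack before it is weakened: `agr` speaks of its variables, and the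
              -- implication holds at every stack.
              (Π′⇒Πₚ s′ (⊨ᴾ-cong s s′ Π′ (++⁻ˡ (concatMap varsᵖ Π′) agr) Π))
              (subst (s′ , h ⊨ˢ_) (++-assoc (map pto Σ₁) (map app Σ₂) _)
                (append-body e c f d f′ d′ x zs γ⃗ (map pto Σ₁ ++ map app Σ₂)
                  (sym (++-assoc (map pto Σ₁) (map app Σ₂) _))
                  (body-transfers s s′ Σ₁ Σ₂ (++⁻ʳ (concatMap varsᵖ Π′) agr))
                  h h₁ h₂ Σ seg h≔))
          where
          s s′ : Stack (Params Ξ ++ Z)
          s  = ++⁺ (params e c f d x) zs
          s′ = ++⁺ (params e c f′ d′ x) zs
          agr = agree-off-β⃗ e c f f′ d d′ x zs _ F-fresh H-fresh

        append-body {Z} e c f d f′ d′ x zs (_ ∷ _ ∷ []) [] refl [] h h₁ h₂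
          (star {h₁ = k₁} {k₂} h₁≔ (app seg′) (emp k₂∅)) seg h≔ =
          -- The recursive atom of `P` takes all of `h`; the empty `k₂` serves again as the heap of
          -- the tail.
          star {h₁ = h} {k₂} (⊎ʰ-emptyʳ {h} {k₂} k₂∅)
            (app (subst (_, h ∈⟦ P ⟧)
                   (cong (params _ _ _ _) (sym (ξ⃗-value e c f′ d′ x zs)))
                   -- The new source is the value of `γ⃗`, and `seg′` is a subderivation. As `k₂` is
                   -- empty, `k₁` reads like `h₁`.
                   (append _ _ f d f′ d′ x h k₁ h₂
                     (cong (params _ _ _ _) (ξ⃗-value e c f d x zs)) seg′ seg
                     (⊎ʰ-respˡ {h} {k₁} {h₁} {h₂} (⊎ʰ-emptyʳ⁻ {h₁} {k₁} {k₂} k₂∅ h₁≔) h≔))))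
            (emp k₂∅)
        append-body e c f d f′ d′ x zs γ⃗ (a ∷ Θ) refl (move ∷ moves) h h₁ h₂
          (star {h₁ = k₁} {k₂} h₁≔ atom rest) seg h≔ =
          -- `k₁` stays with the first atom, and the second segment joins the remaining heap `k₂`.
          let h≔′ , k₂∪h₂≔ = ⊎ʰ-assoc {h} {h₁} {h₂} {k₁} {k₂} h≔ h₁≔
          in star {h₁ = k₁} {k₂ ∪ h₂} h≔′ (move k₁ atom)
               (append-body e c f d f′ d′ x zs γ⃗ Θ refl moves (k₂ ∪ h₂) k₂ h₂ rest seg k₂∪h₂≔)

-- Both entailments as instances of concatenation.

theorem3 : (S : Signature) → let open SL S in
    (rules : Definitions) → let open Semantics rules in
    ∀ {Ξ} (P P′ : CPred Ξ) →
    SyntacticallyCompositional P → SyntacticallyCompositional P′ →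
    P′ StrongerThan P →
    (∀ {Γ} (α β : Vars Γ Pair) (ξ : Vars Γ Ξ) →
    ([] ∧̇ [ P′ ⟨ α ∣ β ∣ ξ ⟩ ]) ⇛ ([] ∧̇ [ P ⟨ α ∣ β ∣ ξ ⟩ ]))
    × (∀ {Γ} (α γ : Vars Γ Pair) (ξ : Vars Γ Ξ) →
    let bound = All.tabulate ∈-++⁺ˡ
        free  = λ {Δ} (xs : Vars Γ Δ) → All.map (∈-++⁺ʳ Pair) xs
    in
    ∃⃗ Pair ([] ∧̇ (P′ ⟨ free α ∣ bound ∣ free ξ ⟩ ∷ P ⟨ bound ∣ free γ ∣ free ξ ⟩ ∷ []))
    ⇛ ([] ∧̇ [ P ⟨ α ∣ γ ∣ ξ ⟩ ]))
theorem3 S rules {Ξ} P P′ scP scP′ P′≽P = weaken , compose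
  where
  open SL S
  open Semantics rules

  weaken : ∀ {Γ} (α β : Vars Γ Pair) (ξ : Vars Γ Ξ) →
           ([] ∧̇ [ P′ ⟨ α ∣ β ∣ ξ ⟩ ]) ⇛ ([] ∧̇ [ P ⟨ α ∣ β ∣ ξ ⟩ ])
  weaken α@(_ ∷ _ ∷ []) β@(_ ∷ _ ∷ []) ξ s h ([] , star {h₁ = h₁} {h₂} h≔ (app seg′) (emp h₂∅)) =
    [] , star {h₁ = h₁} {h₂} h≔
      (app (subst (_, h₁ ∈⟦ P ⟧) (sym (atom-stack-correct S rules s α β ξ))
        (append S rules P P′ scP scP′ P′≽P _ _ _ _ _ _ _ h₁ h₁ (∅ S)
          (atom-stack-correct S rules s α β ξ) seg′
          (empty-segment S rules P P′ scP scP′ P′≽P _ _ _ (∅-empty S))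
          (⊎ʰ-emptyʳ S {h₁} {∅ S} (∅-empty S)))))
      (emp h₂∅)

  compose : ∀ {Γ} (α γ : Vars Γ Pair) (ξ : Vars Γ Ξ) →
    let bound = All.tabulate ∈-++⁺ˡ
        free  = λ {Δ} (xs : Vars Γ Δ) → All.map (∈-++⁺ʳ Pair) xs
    in
    ∃⃗ Pair ([] ∧̇ (P′ ⟨ free α ∣ bound ∣ free ξ ⟩ ∷ P ⟨ bound ∣ free γ ∣ free ξ ⟩ ∷ []))
    ⇛ ([] ∧̇ [ P ⟨ α ∣ γ ∣ ξ ⟩ ])
  compose α@(_ ∷ _ ∷ []) γ@(_ ∷ _ ∷ []) ξ s h
    -- `∃⃗` binds the last sort of `Pair` outermost, so the data witness precedes the location
    -- witness.
    (d , f , [] , star {h₁ = h₁} {h₂} h≔ (app seg′)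
                    (star {h₁ = k₁} {k₂} h₂≔ (app seg) (emp k₂∅))) =
    [] , star {h₁ = h} {∅ S} (⊎ʰ-emptyʳ S {h} {∅ S} (∅-empty S))
      (app (subst (_, h ∈⟦ P ⟧) (sym (atom-stack-correct S rules s α γ ξ))
        (append S rules P P′ scP scP′ P′≽P _ _ f d _ _ _ h h₁ h₂
          (cong (params S rules _ _ _ _) ξ-value) seg′
          -- The tail `k₂` is empty, so the segment on `k₁` also holds on all of `h₂`.
          (∈⟦⟧-resp S rules (⊎ʰ-emptyʳ⁻ S {h₂} {k₁} {k₂} k₂∅ h₂≔)
            (subst (_, k₁ ∈⟦ P ⟧) (cong (params S rules _ _ _ _) ξ-value) seg))
          h≔)))
      (emp (∅-empty S))
    where
    -- Weakened variables skip the two bound values, so both atoms see the static parameters as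
    -- evaluated in `s`.
    ξ-value : All.map (λ u → ⟦ u ⟧ (f ∷ d ∷ s)) (All.map var (All.map (∈-++⁺ʳ Pair) ξ))
              ≡ All.map (All.lookup s) ξ
    ξ-value = trans (Allₚ.map-∘ (All.map (∈-++⁺ʳ Pair) ξ)) (Allₚ.map-∘ ξ)
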